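{- Let $\mathcal{F}$ be an infinite frieze with quiddity row $(a_i)_{i\in\mathbb{Z}}$ such that $a_k=1$ for some integer $k$. Then the sequence $(\check a_i)_{i\in\mathbb{Z}}$ with $$\check a_i=\begin{cases} a_i&\text{if }i\le k-2,\\ a_{k-1}-1&\text{if }i=k-1,\\ a_{k+1}-1&\text{if }i=k,\\ a_{i+1}&\text{if }i\ge k+1,\end{cases}$$ is the quiddity row of an infinite frieze.
   Context: An infinite frieze is an array $(m_{ij})_{i,j\in\mathbb{Z},\,j-i\ge -2}$ of integers with $m_{i,i-2}=0$ and $m_{i,i-1}=1$ for all $i\in\mathbb{Z}$, $m_{ij}>0$ for all $j\ge i$, and $m_{ij}m_{i+1,j+1}-m_{i+1,j}m_{i,j+1}=1$ for all $j-i\ge -1$. Its quiddity row is the sequence $(a_i)_{i\in\mathbb{Z}}$ with $a_i=m_{ii}$. -}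

module Defs where

open import Data.Bool.Base using (if_then_else_)
open import Data.Integer using (ℤ; +_; -_; _+_; _-_; _*_; _≤_; _<_; _≤?_; _≟_; 0ℤ; 1ℤ)
open import Relation.Nullary.Decidable using (does)
open import Relation.Binary.PropositionalEquality using (_≡_)

-- The array is only meant on the half-plane j - i ≥ -2.  It is encoded as a
-- total function whose values at j - i < -2 are arbitrary: no field mentions
-- them (the diamond rule reads m (i + 1) j only where j - (i + 1) ≥ -2).
record InfiniteFrieze : Set where
  field
    m        : ℤ → ℤ → ℤ
    zeros    : ∀ i → m i (i - + 2) ≡ 0ℤ
    ones     : ∀ i → m i (i - 1ℤ) ≡ 1ℤ
    positive : ∀ i j → i ≤ j → 0ℤ < m i j
    diamond  : ∀ i j → - 1ℤ ≤ j - i →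
               m i j * m (i + 1ℤ) (j + 1ℤ) - m (i + 1ℤ) j * m i (j + 1ℤ) ≡ 1ℤ

_IsQuiddityRowOf_ : (ℤ → ℤ) → InfiniteFrieze → Set
a IsQuiddityRowOf F = ∀ i → a i ≡ InfiniteFrieze.m F i i

-- The tests are tried in order, so the last branch is exactly i ≥ k + 1.
reduceAt : ℤ → (ℤ → ℤ) → (ℤ → ℤ)
reduceAt k a i =
  if does (i ≤? k - + 2) then a i
  else if does (i ≟ k - 1ℤ) then a (k - 1ℤ) - 1ℤ
  else if does (i ≟ k) then a (k + 1ℤ) - 1ℤ
  else a (i + 1ℤ)

{-# OPTIONS --safe #-}
module Submission where

-- A frieze entry is m i j = det (V (i - 1), V (j + 1)) for a sequence of plane
-- vectors with V (i + 1) = a i V i - V (i - 1).  The reduced frieze is the one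
-- of the sequence with V k deleted, so its entries are entries of F with row
-- k + 1 and column k - 1 left out.  The only diamonds that are not diamonds of
-- F are those straddling the omitted row or column; there the determinant is
-- det (V (k - 1), V (k + 1)) = a k = 1.

open import Defs
open import Data.Bool.Base using (if_then_else_)
open import Data.Integer
  using (ℤ; +_; -_; _+_; _-_; _*_; _≤_; _<_; _≤?_; _≟_; 0ℤ; 1ℤ; ∣_∣; NonZero; ≢-nonZero)
open import Data.Integer.Properties
open import Data.Integer.Tactic.RingSolver using (solve-∀)
open import Data.Nat.Base as ℕ using (ℕ)
open import Data.Product using (∃-syntax; _,_)
open import Relation.Binary.PropositionalEquality
  using (_≡_; _≢_; refl; sym; trans; cong; cong₂; subst; subst₂; ≢-sym; module ≡-Reasoning)
open import Relation.Nullary using (yes; no; contradiction)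
open import Relation.Nullary.Decidable using (does; dec-true; dec-false)

-- Inequalities and induction on the integers

≤-by-difference : ∀ {i j k l} → i ≤ j → j - i ≡ l - k → k ≤ l
≤-by-difference i≤j eq = 0≤i-j⇒j≤i (subst (0ℤ ≤_) eq (i≤j⇒0≤j-i i≤j))

i≤i+1 : ∀ i → i ≤ i + 1ℤ
i≤i+1 i = subst (i ≤_) (+-comm 1ℤ i) (i≤suc[i] i)

i-1+1≡i : ∀ i → i - 1ℤ + 1ℤ ≡ i
i-1+1≡i = lemma
  where
  lemma : ∀ x → x + - 1ℤ + 1ℤ ≡ x
  lemma = solve-∀

i<j⇒i+1≤j : ∀ {i j} → i < j → i + 1ℤ ≤ j
i<j⇒i+1≤j {i} i<j = subst (_≤ _) (+-comm 1ℤ i) (i<j⇒suc[i]≤j i<j)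

i+1≤j⇒i<j : ∀ {i j} → i + 1ℤ ≤ j → i < j
i+1≤j⇒i<j {i} i+1≤j = suc[i]≤j⇒i<j (subst (_≤ _) (+-comm i 1ℤ) i+1≤j)

≤-induction : ∀ {ℓ} (P : ℤ → Set ℓ) {k} → P k →
              (∀ j → k ≤ j → P j → P (j + 1ℤ)) → ∀ j → k ≤ j → P j
≤-induction P {k} base step j k≤j = subst P k+∣j-k∣≡j (from ∣ j - k ∣)
  where
  assoc : ∀ x y → x + y + 1ℤ ≡ x + (1ℤ + y)
  assoc = solve-∀

  cancel : ∀ x y → x + (y + - x) ≡ y
  cancel = solve-∀

  k+∣j-k∣≡j : k + + ∣ j - k ∣ ≡ j
  k+∣j-k∣≡j = trans (cong (λ z → k + z) (0≤i⇒+∣i∣≡i (i≤j⇒0≤j-i k≤j))) (cancel k j)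

  from : ∀ n → P (k + + n)
  from ℕ.zero    = subst P (sym (+-identityʳ k)) base
  from (ℕ.suc n) = subst P (assoc k (+ n)) (step (k + + n) (i≤i+j k (+ n)) (from n))

-- Increasing enumerations `skip p` of the integers other than `p + 1`

skip : ℤ → ℤ → ℤ
skip p i = if does (i ≤? p) then i else i + 1ℤ

skip-≤ : ∀ {p i} → i ≤ p → skip p i ≡ i
skip-≤ {p} {i} i≤p = cong (if_then i else i + 1ℤ) (dec-true (i ≤? p) i≤p)

skip-> : ∀ {p i} → p < i → skip p i ≡ i + 1ℤ
skip-> {p} {i} p<i = cong (if_then i else i + 1ℤ) (dec-false (i ≤? p) (<⇒≱ p<i))

i≤skip : ∀ p i → i ≤ skip p i
i≤skip p i with i ≤? p
... | yes _ = ≤-refl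
... | no _  = i≤i+1 i

-- Once `i` has passed `p`, `j` has passed `q`, so the column index shifts no later than the row
-- index. This will keep the entries of the reduced frieze on or above the diagonal.
skip-mono : ∀ {p q i j} → q ≤ p → i ≤ j → skip p i ≤ skip q j
skip-mono {p} {q} {i} {j} q≤p i≤j with i ≤? p
... | yes _  = ≤-trans i≤j (i≤skip q j)
... | no i≰p = subst (i + 1ℤ ≤_) (sym (skip-> (≤-<-trans q≤p (<-≤-trans (≰⇒> i≰p) i≤j))))
                 (+-monoˡ-≤ 1ℤ i≤j)

skip-gap : ∀ p → skip p (p + 1ℤ) ≡ p + 1ℤ + 1ℤ
skip-gap p = skip-> {p} (i+1≤j⇒i<j ≤-refl)

skip-+1 : ∀ {p i} → i ≢ p → skip p (i + 1ℤ) ≡ skip p i + 1ℤ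
skip-+1 {p} {i} i≢p with i ≤? p
... | yes i≤p = skip-≤ (i<j⇒i+1≤j (≤∧≢⇒< i≤p i≢p))
... | no i≰p  = skip-> (<-≤-trans (≰⇒> i≰p) (i≤i+1 i))

-- Moving the gap along with the index lets `skip-mono` give bounds of the form
-- `skip p i ≤ skip q j + 1`, the range of the diamond rule.
skip-shift : ∀ p i → skip (p + 1ℤ) (i + 1ℤ) ≡ skip p i + 1ℤ
skip-shift p i with i ≤? p
... | yes i≤p = skip-≤ (+-monoˡ-≤ 1ℤ i≤p)
... | no i≰p  = skip-> (+-monoˡ-< 1ℤ (≰⇒> i≰p))

-- Linear recurrence and stretched diamonds in a frieze

module Frieze (F : InfiniteFrieze) where
  open InfiniteFrieze F public

  diamond′ : ∀ i j → i ≤ j + 1ℤ →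
             m i j * m (i + 1ℤ) (j + 1ℤ) - m (i + 1ℤ) j * m i (j + 1ℤ) ≡ 1ℤ
  diamond′ i j i≤j+1 = diamond i j (≤-by-difference i≤j+1 (lemma i j))
    where
    lemma : ∀ x y → y + 1ℤ + - x ≡ y + - x + - (- 1ℤ)
    lemma = solve-∀

  subdiagonal : ∀ i → m (i + 1ℤ) i ≡ 1ℤ
  subdiagonal i = trans (cong (m (i + 1ℤ)) (lemma i)) (ones (i + 1ℤ))
    where
    lemma : ∀ x → x ≡ x + 1ℤ + - 1ℤ
    lemma = solve-∀

  subsubdiagonal : ∀ i → m (i + 1ℤ + 1ℤ) i ≡ 0ℤ
  subsubdiagonal i = trans (cong (m (i + 1ℤ + 1ℤ)) (lemma i)) (zeros (i + 1ℤ + 1ℤ))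
    where
    lemma : ∀ x → x ≡ x + 1ℤ + 1ℤ + - (+ 2)
    lemma = solve-∀

  -- Supplies the divisor in `row-recurrence`, whose first induction step divides by a boundary
  -- entry 1, out of reach of `positive`.
  m-nonZero : ∀ {i j} → i ≤ j + 1ℤ → NonZero (m i j)
  m-nonZero {i} {j} i≤j+1 with i ≤? j
  ... | yes i≤j = ≢-nonZero (≢-sym (<⇒≢ (positive i j i≤j)))
  ... | no i≰j  =
    subst NonZero (sym (trans (cong (λ x → m x j) i≡j+1) (subdiagonal j))) _
    where
    i≡j+1 : i ≡ j + 1ℤ
    i≡j+1 = ≤-antisym i≤j+1 (i<j⇒i+1≤j (≰⇒> i≰j))

  -- The diamond with one corner on the boundary of ones, solved for the opposite corner. If one of
  -- the two diagonal entries is 1, it gives the other minus 1, as in the changed entries of the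
  -- reduced quiddity row.
  above-diagonal : ∀ i → m i (i + 1ℤ) ≡ m i i * m (i + 1ℤ) (i + 1ℤ) - 1ℤ
  above-diagonal i = begin
    x                ≡⟨ rearrange x p ⟩
    p - (p - 1ℤ * x) ≡⟨ cong (λ u → p - (p - u * x)) (subdiagonal i) ⟨
    p - (p - m (i + 1ℤ) i * x) ≡⟨ cong (λ u → p - u) (diamond′ i i (i≤i+1 i)) ⟩
    p - 1ℤ ∎
    where
    open ≡-Reasoning
    x = m i (i + 1ℤ)
    p = m i i * m (i + 1ℤ) (i + 1ℤ)
    rearrange : ∀ x p → x ≡ p + - (p + - (1ℤ * x))
    rearrange = solve-∀

  -- The relation V (k + 1) = a k V k - V (k - 1), paired with V (j + 1). The diamonds in rows `k`,
  -- `k + 1` and in rows `k + 1`, `k + 2` both equal 1 and cancel, so the ratio of the left side to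
  -- `m (k + 1) j` is independent of `j`.
  row-recurrence : ∀ k j → k ≤ j → m k j + m (k + 1ℤ + 1ℤ) j ≡ m k k * m (k + 1ℤ) j
  row-recurrence k = ≤-induction _ base step
    where
    open ≡-Reasoning

    -- In column `k` the lower two rows meet the boundary 1 and 0, which fixes the ratio at `m k k`.
    base : m k k + m (k + 1ℤ + 1ℤ) k ≡ m k k * m (k + 1ℤ) k
    base = begin
      m k k + m (k + 1ℤ + 1ℤ) k  ≡⟨ cong (λ x → m k k + x) (subsubdiagonal k) ⟩
      m k k + 0ℤ                 ≡⟨ +-identityʳ (m k k) ⟩
      m k k                      ≡⟨ *-identityʳ (m k k) ⟨
      m k k * 1ℤ                 ≡⟨ cong (λ x → m k k * x) (subdiagonal k) ⟨
      m k k * m (k + 1ℤ) k       ∎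

    rearrange : ∀ x y z x′ y′ z′ →
      y * (x′ + z′) ≡ (x + z) * y′ + (y * z′ + - (z * y′)) + - (x * y′ + - (y * x′))
    rearrange = solve-∀

    regroup : ∀ a y y′ → a * y * y′ + 1ℤ + - 1ℤ ≡ y * (a * y′)
    regroup = solve-∀

    step : ∀ j → k ≤ j → m k j + m (k + 1ℤ + 1ℤ) j ≡ m k k * m (k + 1ℤ) j →
           m k (j + 1ℤ) + m (k + 1ℤ + 1ℤ) (j + 1ℤ) ≡ m k k * m (k + 1ℤ) (j + 1ℤ)
    step j k≤j ih = *-cancelˡ-≡ y _ _ {{m-nonZero k+1≤j+1}} (begin
      y * (x′ + z′)
        ≡⟨ rearrange x y z x′ y′ z′ ⟩
      (x + z) * y′ + (y * z′ - z * y′) - (x * y′ - y * x′)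
        ≡⟨ cong₂ (λ u v → (x + z) * y′ + u - v)
             (diamond′ (k + 1ℤ) j k+1≤j+1) (diamond′ k j (≤-trans k≤j (i≤i+1 j))) ⟩
      (x + z) * y′ + 1ℤ - 1ℤ
        ≡⟨ cong (λ u → u * y′ + 1ℤ - 1ℤ) ih ⟩
      m k k * y * y′ + 1ℤ - 1ℤ
        ≡⟨ regroup (m k k) y y′ ⟩
      y * (m k k * y′) ∎)
      where
      x  = m k j
      y  = m (k + 1ℤ) j
      z  = m (k + 1ℤ + 1ℤ) j
      x′ = m k (j + 1ℤ)
      y′ = m (k + 1ℤ) (j + 1ℤ)
      z′ = m (k + 1ℤ + 1ℤ) (j + 1ℤ)
      k+1≤j+1 = +-monoˡ-≤ 1ℤ k≤j

  -- Adding row `k` to row `k + 2` preserves the determinant and, by `row-recurrence`, produces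
  -- `m k k` times row `k + 1`; an ordinary diamond remains.
  tall-diamond : ∀ k j → k ≤ j →
    m k j * m (k + 1ℤ + 1ℤ) (j + 1ℤ) - m (k + 1ℤ + 1ℤ) j * m k (j + 1ℤ) ≡ m k k
  tall-diamond k j k≤j = begin
    x * z′ - z * x′
      ≡⟨ rearrange x z x′ z′ ⟩
    x * (x′ + z′) - (x + z) * x′
      ≡⟨ cong₂ (λ u v → x * u - v * x′)
           (row-recurrence k (j + 1ℤ) k≤j+1) (row-recurrence k j k≤j) ⟩
    x * (a * y′) - a * y * x′
      ≡⟨ regroup a x y x′ y′ ⟩
    a * (x * y′ - y * x′)
      ≡⟨ cong (λ u → a * u) (diamond′ k j k≤j+1) ⟩
    a * 1ℤ
      ≡⟨ *-identityʳ a ⟩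
    a ∎
    where
    open ≡-Reasoning
    a  = m k k
    x  = m k j
    y  = m (k + 1ℤ) j
    z  = m (k + 1ℤ + 1ℤ) j
    x′ = m k (j + 1ℤ)
    y′ = m (k + 1ℤ) (j + 1ℤ)
    z′ = m (k + 1ℤ + 1ℤ) (j + 1ℤ)
    k≤j+1 = ≤-trans k≤j (i≤i+1 j)

    rearrange : ∀ x z x′ z′ → x * z′ + - (z * x′) ≡ x * (x′ + z′) + - ((x + z) * x′)
    rearrange = solve-∀

    regroup : ∀ a x y x′ y′ →
      x * (a * y′) + - (a * y * x′) ≡ a * (x * y′ + - (y * x′))
    regroup = solve-∀

-- Reflection exchanging rows and columns

mirror : InfiniteFrieze → InfiniteFrieze
mirror F = record
  { m        = λ i j → m (- j) (- i)
  ; zeros    = λ i → trans (cong (m (- (i - + 2))) (neg-minus-2 i)) (zeros (- (i - + 2)))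
  ; ones     = λ i → trans (cong (m (- (i - 1ℤ))) (neg-minus-1 i)) (ones (- (i - 1ℤ)))
  ; positive = λ i j i≤j → positive (- j) (- i) (neg-mono-≤ i≤j)
  ; diamond  = λ i j -1≤j-i →
      -- The diamond at `(i , j)` is the original one at `(- (j + 1) , - (i + 1))`.
      trans (swap (m (- j) (- i)) _ (m (- j) (- (i + 1ℤ))) _)
        (subst₂ (λ p q → m (- (j + 1ℤ)) (- (i + 1ℤ)) * m p q
                         - m p (- (i + 1ℤ)) * m (- (j + 1ℤ)) q ≡ 1ℤ)
          (neg-pred j) (neg-pred i)
          (diamond (- (j + 1ℤ)) (- (i + 1ℤ)) (subst (- 1ℤ ≤_) (difference i j) -1≤j-i)))
  }
  where
  open InfiniteFrieze F

  neg-minus-2 : ∀ x → - x ≡ - (x + - (+ 2)) + - (+ 2)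
  neg-minus-2 = solve-∀

  neg-minus-1 : ∀ x → - x ≡ - (x + - 1ℤ) + - 1ℤ
  neg-minus-1 = solve-∀

  neg-pred : ∀ x → - (x + 1ℤ) + 1ℤ ≡ - x
  neg-pred = solve-∀

  difference : ∀ x y → y + - x ≡ - (x + 1ℤ) + - (- (y + 1ℤ))
  difference = solve-∀

  swap : ∀ x y z w → x * y + - (z * w) ≡ y * x + - (z * w)
  swap = solve-∀

module _ (F : InfiniteFrieze) where
  open Frieze F

  -- This is `tall-diamond` in the mirrored frieze. The coefficient sits at `k + 2` because the
  -- skipped column `k + 1` belongs to the vector V (k + 2).
  wide-diamond : ∀ i k → i ≤ k + 1ℤ →
    m i k * m (i + 1ℤ) (k + 1ℤ + 1ℤ) - m (i + 1ℤ) k * m i (k + 1ℤ + 1ℤ)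
      ≡ m (k + 1ℤ + 1ℤ) (k + 1ℤ + 1ℤ)
  wide-diamond i k i≤k+1 = begin
    m i k * m i′ k′ - m i′ k * m i k′
      ≡⟨ swap (m i k) (m i′ k′) (m i′ k) (m i k′) ⟩
    m i′ k′ * m i k - m i′ k * m i k′
      ≡⟨ cong₂ _-_
           (cong₂ _*_ (cong₂ m (neg-involutive i′) (neg-involutive k′))
                      (cong₂ m (neg-pred i) (neg-pred² k)))
           (cong₂ _*_ (cong₂ m (neg-involutive i′) (neg-pred² k))
                      (cong₂ m (neg-pred i) (neg-involutive k′))) ⟨
    M (- k′) (- i′) * M (- k′ + 1ℤ + 1ℤ) (- i′ + 1ℤ) - M (- k′ + 1ℤ + 1ℤ) (- i′) * M (- k′) (- i′ + 1ℤ)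
      ≡⟨ Frieze.tall-diamond (mirror F) (- k′) (- i′) (neg-mono-≤ (+-monoˡ-≤ 1ℤ i≤k+1)) ⟩
    M (- k′) (- k′)
      ≡⟨ cong₂ m (neg-involutive k′) (neg-involutive k′) ⟩
    m k′ k′ ∎
    where
    open ≡-Reasoning
    M  = InfiniteFrieze.m (mirror F)
    i′ = i + 1ℤ
    k′ = k + 1ℤ + 1ℤ

    neg-pred : ∀ x → - (- (x + 1ℤ) + 1ℤ) ≡ x
    neg-pred = solve-∀

    neg-pred² : ∀ x → - (- (x + 1ℤ + 1ℤ) + 1ℤ + 1ℤ) ≡ x
    neg-pred² = solve-∀

    swap : ∀ x y z w → x * y + - (z * w) ≡ y * x + - (z * w)
    swap = solve-∀

  -- The reduced frieze

  module _ (k : ℤ) (mkk≡1 : m k k ≡ 1ℤ) where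

    private
      -- Chosen so that `skip c` omits column `k - 1`, while `skip k` omits row `k + 1`: the two
      -- places where V k occurs.
      c = k - + 2

      c+2≡k : c + 1ℤ + 1ℤ ≡ k
      c+2≡k = lemma k
        where
        lemma : ∀ x → x + - (+ 2) + 1ℤ + 1ℤ ≡ x
        lemma = solve-∀

      c+1≤k : c + 1ℤ ≤ k
      c+1≤k = subst (c + 1ℤ ≤_) c+2≡k (i≤i+1 (c + 1ℤ))

      c≤k : c ≤ k
      c≤k = ≤-trans (i≤i+1 c) c+1≤k

      c<k : c < k
      c<k = i+1≤j⇒i<j c+1≤k

    reduced : ℤ → ℤ → ℤ
    reduced i j = m (skip k i) (skip c j)

    -- Since `i - 2 ≤ c` exactly when `i ≤ k`, row and column shift together.
    reduced-zeros : ∀ i → reduced i (i - + 2) ≡ 0ℤ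
    reduced-zeros i with i ≤? k
    ... | yes i≤k = trans (cong (m i) (skip-≤ (+-monoˡ-≤ (- + 2) i≤k))) (zeros i)
    ... | no i≰k  =
      trans (cong (m (i + 1ℤ)) (trans (skip-> (+-monoˡ-< (- + 2) (≰⇒> i≰k))) (lemma i)))
            (zeros (i + 1ℤ))
      where
      lemma : ∀ x → x + - (+ 2) + 1ℤ ≡ x + 1ℤ + - (+ 2)
      lemma = solve-∀

    reduced-ones : ∀ i → reduced i (i - 1ℤ) ≡ 1ℤ
    reduced-ones i with i ≟ k
    -- The column has passed its gap and the row has not, so the entry is `m k k`.
    ... | yes refl = trans (cong₂ m (skip-≤ ≤-refl) (trans (skip-> c<k-1) (i-1+1≡i k))) mkk≡1
      where
      c<k-1 : c < k - 1ℤ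
      c<k-1 = +-monoʳ-< k (neg-mono-< {1ℤ} {+ 2} (i+1≤j⇒i<j ≤-refl))
    ... | no i≢k with i ≤? k
    ...   | yes i≤k =
      trans (cong (m i) (skip-≤ (≤-by-difference (i<j⇒i+1≤j (≤∧≢⇒< i≤k i≢k)) (lemma i k)))) (ones i)
      where
      lemma : ∀ x y → y + - (x + 1ℤ) ≡ y + - (+ 2) + - (x + - 1ℤ)
      lemma = solve-∀
    ...   | no i≰k  =
      trans (cong (m (i + 1ℤ)) (trans (skip-> c<i-1) (lemma i))) (ones (i + 1ℤ))
      where
      lemma : ∀ x → x + - 1ℤ + 1ℤ ≡ x + 1ℤ + - 1ℤ
      lemma = solve-∀

      c<i-1 : c < i - 1ℤ
      c<i-1 = +-mono-<-≤ (≰⇒> i≰k) (neg-mono-≤ {1ℤ} {+ 2} (i≤i+1 1ℤ))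

    reduced-positive : ∀ i j → i ≤ j → 0ℤ < reduced i j
    reduced-positive i j i≤j = positive _ _ (skip-mono c≤k i≤j)

    reduced-diamond : ∀ i j → i ≤ j + 1ℤ →
      reduced i j * reduced (i + 1ℤ) (j + 1ℤ) - reduced (i + 1ℤ) j * reduced i (j + 1ℤ) ≡ 1ℤ
    reduced-diamond i j i≤j+1 with i ≟ k | j ≟ c
    -- No gap is straddled. The column gap is moved to `c + 1`, still at most `k`, to cover
    -- `i ≤ j + 1`.
    ... | no i≢k | no j≢c
      rewrite skip-+1 i≢k | skip-+1 j≢c =
      diamond′ (skip k i) (skip c j)
        (subst (skip k i ≤_) (skip-shift c j) (skip-mono c+1≤k i≤j+1))
    ... | yes refl | no j≢c
      rewrite skip-≤ {k} {k} ≤-refl | skip-gap k | skip-+1 j≢c =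
      trans (tall-diamond k (skip c j) k≤skip) mkk≡1
      where
      c<j : c < j
      c<j = i+1≤j⇒i<j (≤-by-difference i≤j+1 (lemma k j))
        where
        lemma : ∀ x y → y + 1ℤ + - x ≡ y + - (x + - (+ 2) + 1ℤ)
        lemma = solve-∀

      k≤skip : k ≤ skip c j
      k≤skip = subst (k ≤_) (sym (skip-> c<j)) i≤j+1
    -- Straddling both gaps would force `k ≤ k - 1`.
    ... | yes refl | yes refl =
      contradiction i≤j+1 (<⇒≱ (subst (c + 1ℤ <_) c+2≡k (i+1≤j⇒i<j ≤-refl)))
    -- Columns `c` and `c + 2` are involved, and `i ≤ c + 1 ≤ k` leaves the rows unshifted.
    ... | no i≢k | yes refl
      rewrite skip-+1 i≢k | skip-≤ {c} {c} ≤-refl | skip-gap c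
            | skip-≤ {k} {i} (≤-trans i≤j+1 c+1≤k) =
      trans (wide-diamond i c i≤j+1) (trans (cong₂ m c+2≡k c+2≡k) mkk≡1)

    reduce : InfiniteFrieze
    reduce = record
      { m        = reduced
      ; zeros    = reduced-zeros
      ; ones     = reduced-ones
      ; positive = reduced-positive
      ; diamond  = λ i j -1≤j-i → reduced-diamond i j (≤-by-difference -1≤j-i (lemma i j))
      }
      where
      lemma : ∀ x y → y + - x + - (- 1ℤ) ≡ y + 1ℤ + - x
      lemma = solve-∀

    -- The quiddity row of the reduced frieze

    reduce-quiddity : ∀ a → a IsQuiddityRowOf F → reduceAt k a IsQuiddityRowOf reduce
    -- This test decides the first branch of `reduceAt` and also the column `skip c i`, which is
    -- `i + 1` in all later cases.
    reduce-quiddity a q i with i ≤? k - + 2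
    ... | yes i≤c = trans (q i) (cong (λ x → m x i) (sym (skip-≤ (≤-trans i≤c c≤k))))
    ... | no i≰c with i ≟ k - 1ℤ
    -- The row is still before its gap, so the entry is `m (k - 1) k`, just above the diagonal.
    ...   | yes refl = begin
      a i - 1ℤ              ≡⟨ cong (_- 1ℤ) (q i) ⟩
      m i i - 1ℤ            ≡⟨ cong (_- 1ℤ) (*-identityʳ (m i i)) ⟨
      m i i * 1ℤ - 1ℤ       ≡⟨ cong (λ x → m i i * x - 1ℤ) (trans (cong₂ m i+1≡k i+1≡k) mkk≡1) ⟨
      m i i * m (i + 1ℤ) (i + 1ℤ) - 1ℤ ≡⟨ above-diagonal i ⟨
      m i (i + 1ℤ)          ≡⟨ cong (λ x → m x (i + 1ℤ)) (skip-≤ (i≤j⇒i-k≤j 1ℤ ≤-refl)) ⟨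
      m (skip k i) (i + 1ℤ) ∎
      where
      open ≡-Reasoning
      i+1≡k : i + 1ℤ ≡ k
      i+1≡k = i-1+1≡i k
    ...   | no i≢k-1 with i ≟ k
    ...     | yes refl = begin
      a (k + 1ℤ) - 1ℤ           ≡⟨ cong (_- 1ℤ) (q (k + 1ℤ)) ⟩
      d - 1ℤ                    ≡⟨ cong (_- 1ℤ) (*-identityˡ d) ⟨
      1ℤ * d - 1ℤ               ≡⟨ cong (λ x → x * d - 1ℤ) mkk≡1 ⟨
      m k k * d - 1ℤ            ≡⟨ above-diagonal k ⟨
      m k (k + 1ℤ)              ≡⟨ cong (λ x → m x (k + 1ℤ)) (skip-≤ {k} ≤-refl) ⟨
      m (skip k k) (k + 1ℤ)     ∎
      where
      open ≡-Reasoning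
      d = m (k + 1ℤ) (k + 1ℤ)
    -- Here `i > k - 2` with `k - 1` and `k` excluded, so the row has passed its gap too.
    ...     | no i≢k = trans (q (i + 1ℤ)) (cong (λ x → m x (i + 1ℤ)) (sym (skip-> k<i)))
      where
      k-1≤i : k - 1ℤ ≤ i
      k-1≤i = subst (_≤ i) (lemma k) (i<j⇒i+1≤j (≰⇒> i≰c))
        where
        lemma : ∀ x → x + - (+ 2) + 1ℤ ≡ x + - 1ℤ
        lemma = solve-∀

      k≤i : k ≤ i
      k≤i = subst (_≤ i) (i-1+1≡i k) (i<j⇒i+1≤j (≤∧≢⇒< k-1≤i (≢-sym i≢k-1)))

      k<i : k < i
      k<i = ≤∧≢⇒< k≤i (≢-sym i≢k)

theorem2p7 : (F : InfiniteFrieze) (a : ℤ → ℤ) → a IsQuiddityRowOf F →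
    (k : ℤ) → a k ≡ 1ℤ →
    ∃[ G ] (reduceAt k a IsQuiddityRowOf G)
theorem2p7 F a q k ak≡1 = reduce F k mkk≡1 , reduce-quiddity F k mkk≡1 a q
  where mkk≡1 = trans (sym (q k)) ak≡1
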